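{- Let $U$ be a countably infinite universe and $\mathcal{C}=(L_1,L_2,\ldots)$ a countably infinite collection of languages over $U$, and let $m^\star(L_j)$ be the values computed by the Procedure described in the context. Suppose that for every $t\in\mathbb{N}$, the set $\{j: m^\star(L_j)+1\le t\}$ is finite. Then there exists an algorithm that non-uniformly generates from $\mathcal{C}$ with generation times forming a Pareto-optimal sequence.
   Context: A language is an infinite subset of $U$. A collection is a sequence of languages; repetitions are allowed and entries are distinguished by their index. An enumeration of a language $L$ is a sequence $x_1,x_2,\ldots$ with every $x_t\in L$ and every $x\in L$ equal to some $x_t$. A generating algorithm at each time $t\ge1$ receives $x_1,\ldots,x_t$ and outputs $z_t\in U$; $S_t$ is the set of distinct strings among $x_1,\ldots,x_t$. An algorithm non-uniformly generates from $\mathcal{C}$ with (finite) generation times $t(L_i)$ if for every $i$ and every enumeration of $L_i$, $z_t\in L_i\setminus S_t$ whenever $|S_t|\ge t(L_i)$. For an algorithm $\mathcal{G}$, $t_{\mathcal{G}}(L_i)$ denotes the least such value for $L_i$ ($\infty$ if none). A sequence $t(L_1),t(L_2),\ldots$ is Pareto-optimal if every algorithm $\mathcal{G}$ that non-uniformly generates from $\mathcal{C}$ and satisfies $t_{\mathcal{G}}(L_i)<t(L_i)$ for some $i$ also satisfies $t_{\mathcal{G}}(L_j)>t(L_j)$ for some other $j$. Procedure. Set $\mathcal{C}'_0=()$. For $i=1,2,3,\ldots$: append the entry $L_i$ at the end of $\mathcal{C}'_{i-1}$ to get $\mathcal{C}'_i=(L'_1,\ldots,L'_i)$, and set $j=i$.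 Repeat: (1) among all subcollections $\mathcal{D}$ of the entries $(L'_1,\ldots,L'_j)$ that include the entry $L'_j$ and satisfy $|\bigcap_{L\in\mathcal{D}}L|<\infty$, let $m_{\mathrm{chk}}$ be the maximum of $|\bigcap_{L\in\mathcal{D}}L|$ and $\mathcal{C}_{\mathrm{chk}}$ a maximizer; if no such $\mathcal{D}$ exists, set $\mathcal{C}_{\mathrm{chk}}=()$, $m_{\mathrm{chk}}=0$. (2) If $j\le1$ or $m_{\mathrm{chk}}>m^\star(L'_{j-1})$ (already fixed since $L'_{j-1}$ has original index $<i$), stop the loop. (3) Otherwise swap positions $j-1$ and $j$ in $\mathcal{C}'_i$, set $j\leftarrow j-1$ and return to (1). When the loop stops, set $\mathcal{C}(L_i)=\mathcal{C}_{\mathrm{chk}}$ and $m^\star(L_i)=m_{\mathrm{chk}}$. -}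

module Defs where

open import Axiom.ExcludedMiddle using (ExcludedMiddle)
open import Data.Bool using (if_then_else_)
open import Data.Fin using (toℕ)
open import Data.List using (List; []; _∷_; _++_; length; map; mapMaybe)
open import Data.List.Extrema.Nat using (max)
open import Data.List.Membership.Propositional using (_∈_)
open import Data.List.Relation.Unary.All using (All)
open import Data.List.Relation.Unary.Unique.Propositional using (Unique)
open import Data.Maybe using (Maybe; just; nothing)
open import Data.Nat using (ℕ; zero; suc; _≤_; _<_; _<?_)
open import Data.Product using (Σ-syntax; ∃-syntax; _×_; _,_; proj₁; proj₂)
open import Data.Vec using (Vec; tabulate)
import Data.Vec.Membership.Propositional as Vec
open import Function using (_∘_)
open import Function.Bundles using (_⇔_)
open import Level using (0ℓ)
open import Relation.Binary.PropositionalEquality using (_≡_; _≢_)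
open import Relation.Nullary using (¬_; yes; no; does)
open import Relation.Unary using (Pred)

HasSize : {A : Set} → Pred A 0ℓ → ℕ → Set
HasSize {A} P n =
  Σ[ xs ∈ List A ] Unique xs × length xs ≡ n × (∀ a → a ∈ xs ⇔ P a)

Finite : {A : Set} → Pred A 0ℓ → Set
Finite P = ∃[ n ] HasSize P n

Infinite : {A : Set} → Pred A 0ℓ → Set
Infinite P = ¬ Finite P

record Language (U : Set) : Set₁ where
  field
    strings  : Pred U 0ℓ
    infinite : Infinite strings

open Language public

-- The language L_{i+1} is the value at i; an entry is named by its index, so
-- equal languages at different indices remain distinct entries.
Collection : Set → Set₁
Collection U = ℕ → Language U

-- Sequences are 0-based: the string x_{t+1} is x t, the sample x_1, …, x_{t+1}
-- is prefix x t, and S_{t+1} is seen x t.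

Enumerates : {U : Set} → (ℕ → U) → Language U → Set
Enumerates x L = (∀ t → strings L (x t)) × (∀ u → strings L u → ∃[ t ] x t ≡ u)

prefix : {U : Set} → (ℕ → U) → (t : ℕ) → Vec U (suc t)
prefix x t = tabulate (x ∘ toℕ)

seen : {U : Set} → (ℕ → U) → ℕ → Pred U 0ℓ
seen x t u = u Vec.∈ prefix x t

Algorithm : Set → Set
Algorithm U = ∀ {t} → Vec U (suc t) → U

-- Generation times are positive integers.  As |S_t| ≥ 1 always, 0 and 1 would
-- impose the same condition on the algorithm.
GeneratesFrom : {U : Set} → Algorithm U → Language U → ℕ → Set
GeneratesFrom G L k =
  1 ≤ k ×
  (∀ x → Enumerates x L → ∀ t n → HasSize (seen x t) n → k ≤ n →
   strings L (G (prefix x t)) × ¬ seen x t (G (prefix x t)))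

NonUniformlyGeneratesWith : {U : Set} → Algorithm U → Collection U → (ℕ → ℕ) → Set
NonUniformlyGeneratesWith G C τ = ∀ i → GeneratesFrom G (C i) (τ i)

NonUniformlyGenerates : {U : Set} → Algorithm U → Collection U → Set
NonUniformlyGenerates G C = ∃[ τ ] NonUniformlyGeneratesWith G C τ

-- t_G(L) = k, for finite k.
IsGenerationTime : {U : Set} → Algorithm U → Language U → ℕ → Set
IsGenerationTime G L k =
  GeneratesFrom G L k × (∀ k′ → GeneratesFrom G L k′ → k ≤ k′)

-- Only algorithms that non-uniformly generate from C are compared, and their
-- generation times are all finite, so the value ∞ of t_G plays no role.
ParetoOptimal : {U : Set} → Collection U → (ℕ → ℕ) → Set
ParetoOptimal {U} C τ =
  (G : Algorithm U) → NonUniformlyGenerates G C →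
  ∀ i → (∃[ k ] (IsGenerationTime G (C i) k × k < τ i)) →
  ∃[ j ] (j ≢ i × ∃[ k ] (IsGenerationTime G (C j) k × τ j < k))

subcollections : {A : Set} → List A → List (List A)
subcollections []       = [] ∷ []
subcollections (a ∷ as) = subcollections as ++ map (a ∷_) (subcollections as)

module Procedure {U : Set} (em : ExcludedMiddle 0ℓ) (C : Collection U) where

  ⋂ : List ℕ → Pred U 0ℓ
  ⋂ D u = All (λ i → strings (C i) u) D

  sizeIfFinite : Pred U 0ℓ → Maybe ℕ
  sizeIfFinite P with em {Finite P}
  ... | yes (n , _) = just n
  ... | no _        = nothing

  record Entry : Set where
    constructor entry
    field
      index : ℕ
      m     : ℕ

  open Entry public

  -- The value m_chk for the entry i placed right after the given entries.  The
  -- first argument 0 of max is both the value when every intersection is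
  -- infinite and neutral otherwise.
  m-chk : ℕ → List Entry → ℕ
  m-chk i es =
    max 0 (mapMaybe (sizeIfFinite ∘ ⋂) (map (i ∷_) (subcollections (map index es))))

  -- Lists of entries are stored in reverse, with the last position L'_j at the
  -- head, since the loop moves the new entry i from the end towards the front.
  -- The result is m⋆(L_i) together with the updated (reversed) list.
  insert : ℕ → List Entry → ℕ × List Entry
  insert i []       = m-chk i [] , entry i (m-chk i []) ∷ []
  insert i (e ∷ es) =
    if does (m e <? m-chk i (e ∷ es))
    then (m-chk i (e ∷ es) , entry i (m-chk i (e ∷ es)) ∷ e ∷ es)
    else (proj₁ (insert i es) , e ∷ proj₂ (insert i es))

  -- The reversal of C'_i.
  stage : ℕ → List Entry
  stage zero    = []
  stage (suc i) = proj₂ (insert i (stage i))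

  m⋆ : ℕ → ℕ
  m⋆ i = proj₁ (insert i (stage i))

{-# OPTIONS --safe #-}

-- The procedure keeps its list sorted by m⋆, and the new entry i moves in front
-- of an entry f only if no finite intersection of i with entries up to f has more
-- than m⋆ f elements.  Hence every finite intersection ⋂ D of a nonempty D has
-- size at most m⋆ j for some j ∈ D: insert the last index of D, and take for j
-- the last member of D that it passes, or itself.
--
-- Generation in time m⋆ + 1: having seen a set S of n strings, output a new
-- string of the intersection of all L_j ⊇ S with m⋆ j + 1 ≤ n.  By hypothesis
-- there are finitely many such j, so if this intersection were contained in S
-- it would be a finite intersection of size n > m⋆ j for all its members j.
--
-- Pareto optimality: if m⋆ i > 0, then m⋆ i = |⋂ (i ∷ D)| with m⋆ j < m⋆ i for
-- all j ∈ D.  After seeing exactly ⋂ (i ∷ D), an algorithm cannot output a new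
-- string lying in all these languages.  If it succeeds on L_i it fails on some
-- L_j with j ∈ D, and then its time for L_j exceeds m⋆ i ≥ m⋆ j + 1.

module Submission where

open import Defs
open import Axiom.DoubleNegationElimination using (em⇒dne)
open import Axiom.ExcludedMiddle using (ExcludedMiddle)
open import Data.Bool using (if_then_else_)
open import Data.Fin using (toℕ)
open import Data.List using (List; []; _∷_; length; map; mapMaybe; filter)
open import Data.List.Extrema.Nat using (max; argmax-sel; v≤max⁺)
open import Data.List.Membership.Propositional using (_∈_; find; lose)
open import Data.List.Membership.Propositional.Properties using (∈-++⁺ˡ; ∈-++⁺ʳ; ∈-++⁻; ∈-filter⁺; ∈-filter⁻; ∈-map⁺; ∈-map⁻)
open import Data.List.Membership.Propositional.Properties.WithK using (unique∧set⇒bag)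
open import Data.List.Membership.DecPropositional using () renaming (_∈?_ to member?)
open import Data.List.Relation.Binary.BagAndSetEquality using (∼bag⇒↭)
open import Data.List.Relation.Binary.Permutation.Propositional using (_↭_; ↭-refl; ↭-sym; ↭-trans; ↭-prep; ↭-swap)
open import Data.List.Relation.Binary.Permutation.Propositional.Properties using (All-resp-↭; ∈-resp-↭; ↭-length; map⁺)
open import Data.List.Relation.Unary.All as All using (All; []; _∷_)
open import Data.List.Relation.Unary.All.Properties using (¬Any⇒All¬)
open import Data.List.Relation.Unary.AllPairs using (AllPairs; []; _∷_)
open import Data.List.Relation.Unary.Any using (Any; here; there)
open import Data.Maybe using (Maybe; just; nothing)
open import Data.Nat using (ℕ; zero; suc; _+_; _≤_; _<_; _<?_; s≤s; s≤s⁻¹; z≤n)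
open import Data.Nat.Induction using (<-rec)
open import Data.Nat.Properties using (_≟_; ≤-refl; ≤-trans; ≤-<-trans; <-≤-trans; ≮⇒≥; ≰⇒>; <⇒≤; <⇒≱; <⇒≢; <-irrefl; n<1+n; m<n⇒m<1+n; m<1+n⇒m<n∨m≡n; +-comm; m≤n+m; m<m+n)
open import Data.Product using (Σ-syntax; ∃-syntax; _×_; _,_; proj₁; proj₂)
open import Data.Sum using (_⊎_; inj₁; inj₂)
open import Data.Vec as Vec using (Vec; tabulate; fromList)
import Data.Vec.Membership.Propositional as Vec
open import Data.Vec.Membership.Propositional.Properties using (∈-fromList⁺; ∈-fromList⁻)
import Data.Vec.Relation.Unary.Any.Properties as VecAny
open import Function using (_∘_; id)
open import Function.Bundles using (_↔_; _⇔_; mk⇔; Equivalence; Inverse)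
open import Function.Properties.Equivalence renaming (sym to ⇔-sym; trans to ⇔-trans) using ()
open import Level using (0ℓ)
open import Relation.Binary.PropositionalEquality using (_≡_; _≢_; refl; sym; trans; cong; subst)
open import Relation.Nullary using (¬_; yes; no; Dec; does; contradiction)
open import Relation.Unary using (Pred; Decidable)

open Equivalence using (to; from)

-- Sizes of finite predicates, and lists.

private
  variable
    A : Set
    P Q : Pred A 0ℓ

HasSize-resp : (∀ a → P a ⇔ Q a) → ∀ {n} → HasSize P n → HasSize Q n
HasSize-resp P⇔Q (xs , uniq , len , mem) = xs , uniq , len , λ a → ⇔-trans (mem a) (P⇔Q a)

-- Duplicate-free lists with the same members are permutations of each other.
HasSize-unique : ∀ {m n} → HasSize P m → HasSize P n → m ≡ n
HasSize-unique (xs , uxs , refl , memx) (ys , uys , refl , memy) =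
  ↭-length (∼bag⇒↭ (unique∧set⇒bag uxs uys (λ {a} → ⇔-trans (memx a) (⇔-sym (memy a)))))

∈-mapMaybe⁺ : {A B : Set} (f : A → Maybe B) {a : A} {b : B} {as : List A} →
              a ∈ as → f a ≡ just b → b ∈ mapMaybe f as
∈-mapMaybe⁺ f {a} (here refl) eq with f a | eq
... | just _ | refl = here refl
∈-mapMaybe⁺ f {as = a′ ∷ _} (there a∈) eq with f a′
... | just _  = there (∈-mapMaybe⁺ f a∈ eq)
... | nothing = ∈-mapMaybe⁺ f a∈ eq

∈-mapMaybe⁻ : {A B : Set} (f : A → Maybe B) {b : B} (as : List A) →
              b ∈ mapMaybe f as → ∃[ a ] (a ∈ as × f a ≡ just b)
∈-mapMaybe⁻ f (a ∷ as) b∈ with f a in eq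
∈-mapMaybe⁻ f (a ∷ as) (here refl) | just _ = a , here refl , eq
∈-mapMaybe⁻ f (a ∷ as) (there b∈)  | just _ =
  let a′ , a′∈ , eq′ = ∈-mapMaybe⁻ f as b∈ in a′ , there a′∈ , eq′
∈-mapMaybe⁻ f (a ∷ as) b∈          | nothing =
  let a′ , a′∈ , eq′ = ∈-mapMaybe⁻ f as b∈ in a′ , there a′∈ , eq′

filter∈subcollections : (P? : Decidable P) (as : List A) → filter P? as ∈ subcollections as
filter∈subcollections P? []       = here refl
filter∈subcollections P? (a ∷ as) with P? a
... | yes _ = ∈-++⁺ʳ (subcollections as) (∈-map⁺ (a ∷_) (filter∈subcollections P? as))
... | no  _ = ∈-++⁺ˡ (filter∈subcollections P? as)

∈-subcollections⇒⊆ : (as : List A) {D : List A} → D ∈ subcollections as → ∀ {d} → d ∈ D → d ∈ as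
∈-subcollections⇒⊆ [] (here refl) ()
∈-subcollections⇒⊆ (a ∷ as) D∈ d∈ with ∈-++⁻ (subcollections as) D∈
... | inj₁ D∈as = there (∈-subcollections⇒⊆ as D∈as d∈)
... | inj₂ D∈map with ∈-map⁻ (a ∷_) D∈map
... | D′ , D′∈ , refl with d∈
... | here refl = here refl
... | there d∈′ = there (∈-subcollections⇒⊆ as D′∈ d∈′)

-- Enumerations that begin with a given sample.

_followedBy_ : List A → (ℕ → A) → ℕ → A
([]       followedBy g) t       = g t
((a ∷ as) followedBy g) zero    = a
((a ∷ as) followedBy g) (suc t) = (as followedBy g) t

tabulate-followedBy : (as : List A) (g : ℕ → A) →
                      tabulate {n = length as} ((as followedBy g) ∘ toℕ) ≡ fromList as
tabulate-followedBy []       g = refl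
tabulate-followedBy (a ∷ as) g = cong (a Vec.∷_) (tabulate-followedBy as g)

followedBy-All : (as : List A) {g : ℕ → A} → All P as → (∀ t → P (g t)) →
                 ∀ t → P ((as followedBy g) t)
followedBy-All []       []       pg t       = pg t
followedBy-All (a ∷ as) (p ∷ ps) pg zero    = p
followedBy-All (a ∷ as) (p ∷ ps) pg (suc t) = followedBy-All as ps pg t

followedBy-hits : (as : List A) {g : ℕ → A} {a : A} →
                  ∃[ t ] g t ≡ a → ∃[ t ] (as followedBy g) t ≡ a
followedBy-hits []       hit = hit
followedBy-hits (_ ∷ as) hit = let t , eq = followedBy-hits as hit in suc t , eq

module _ (em : ExcludedMiddle 0ℓ) where

  least : (P : Pred ℕ 0ℓ) → ∀ k → P k → ∃[ l ] (P l × (∀ k′ → P k′ → l ≤ k′))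
  least P = <-rec _ λ k rec pk → case k rec pk (em {∃[ k′ ] (k′ < k × P k′)})
    where
    case : ∀ k → (∀ {k′} → k′ < k → P k′ → ∃[ l ] (P l × (∀ k″ → P k″ → l ≤ k″))) → P k →
           Dec (∃[ k′ ] (k′ < k × P k′)) → ∃[ l ] (P l × (∀ k″ → P k″ → l ≤ k″))
    case k rec pk (yes (k′ , k′<k , pk′)) = rec k′<k pk′
    case k rec pk (no ¬smaller)           = k , pk , λ k′ pk′ → ≮⇒≥ λ k′<k → ¬smaller (k′ , k′<k , pk′)

  -- After the sample, run through `U` along the bijection and put `s` in place of every string
  -- outside `L`.
  enumerationExtending : {U : Set} → U ↔ ℕ → (L : Language U) (s : U) (ss : List U) →
                         All (strings L) (s ∷ ss) →
                         ∃[ x ] (Enumerates x L × prefix x (length ss) ≡ fromList (s ∷ ss))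
  enumerationExtending {U} U↔ℕ L s ss s∷ss⊆L@(s∈L ∷ _) =
    (s ∷ ss) followedBy g ,
    (followedBy-All (s ∷ ss) s∷ss⊆L g∈L , λ u u∈L → followedBy-hits (s ∷ ss) (g-hits u u∈L)) ,
    tabulate-followedBy (s ∷ ss) g
    where
    module U = Inverse U↔ℕ

    orS : (u : U) → Dec (strings L u) → U
    orS u (yes _) = u
    orS u (no _)  = s

    g : ℕ → U
    g t = orS (U.from t) em

    orS∈L : ∀ u d → strings L (orS u d)
    orS∈L u (yes u∈L) = u∈L
    orS∈L u (no _)    = s∈L

    g∈L : ∀ t → strings L (g t)
    g∈L t = orS∈L (U.from t) em

    orS-id : ∀ u d → strings L u → orS u d ≡ u
    orS-id u (yes _)  _   = refl
    orS-id u (no u∉L) u∈L = contradiction u∈L u∉L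

    g-hits : ∀ u → strings L u → ∃[ t ] g t ≡ u
    g-hits u u∈L = U.to u , trans (cong (λ v → orS v em) (U.strictlyInverseʳ u)) (orS-id u em u∈L)

  -- Every finite sample inside `L` begins some enumeration of `L`. The guarantee thus depends on a
  -- bare list, and one list can test `G` on several languages at once.
  generatesFrom-fresh : {U : Set} → U ↔ ℕ → ∀ {G : Algorithm U} {L k s ss n} → GeneratesFrom G L k →
                        All (strings L) (s ∷ ss) → HasSize (_∈ s ∷ ss) n → k ≤ n →
                        strings L (G (fromList (s ∷ ss))) × ¬ (G (fromList (s ∷ ss)) ∈ s ∷ ss)
  generatesFrom-fresh U↔ℕ {G} {L} {s = s} {ss} {n} (_ , gen) ⊆L size k≤n =
    let x , enum , eq = enumerationExtending U↔ℕ L s ss ⊆L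
        ∈L , fresh = subst
          (λ v → HasSize (Vec._∈ v) n → strings L (G v) × ¬ (G v Vec.∈ v)) eq
          (λ size′ → gen x enum (length ss) n size′ k≤n)
          (HasSize-resp (λ _ → mk⇔ ∈-fromList⁺ ∈-fromList⁻) size)
    in ∈L , fresh ∘ ∈-fromList⁺

  module _ {U : Set} (C : Collection U) where

    open Procedure em C

    -- Finite intersections and `m-chk`.

    sizeIfFinite-sound : ∀ P {n} → sizeIfFinite P ≡ just n → HasSize P n
    sizeIfFinite-sound P eq with em {Finite P} | eq
    ... | yes (_ , size) | refl = size

    sizeIfFinite-complete : ∀ P {n} → HasSize P n → sizeIfFinite P ≡ just n
    sizeIfFinite-complete P size with em {Finite P}
    ... | yes (_ , size′) = cong just (HasSize-unique {P = P} size′ size)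
    ... | no ¬finite      = contradiction (_ , size) ¬finite

    ⋂-anti : ∀ {D E} → (∀ {j} → j ∈ D → j ∈ E) → ∀ {u} → ⋂ E u → ⋂ D u
    ⋂-anti D⊆E u∈⋂E = All.tabulate λ j∈D → All.lookup u∈⋂E (D⊆E j∈D)

    -- Only the set of members of `D` matters for `⋂ D`. So `D` may be replaced by `i` followed by
    -- the earlier indices that lie in `D`, which is a candidate in `m-chk`.
    ⋂-size≤m-chk : ∀ i es {D n} → i ∈ D → (∀ {j} → j ∈ D → j ∈ i ∷ map index es) →
                   HasSize (⋂ D) n → n ≤ m-chk i es
    ⋂-size≤m-chk i es {D} {n} i∈D D⊆ size =
      v≤max⁺ 0 _ (inj₂ (lose
        (∈-mapMaybe⁺ (sizeIfFinite ∘ ⋂)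
          (∈-map⁺ (i ∷_) (filter∈subcollections (λ j → member? _≟_ j D) is))
          (sizeIfFinite-complete (⋂ (i ∷ D′))
            (HasSize-resp (λ _ → mk⇔ (⋂-anti D′⊆D) (⋂-anti D⊆D′)) size)))
        ≤-refl))
      where
      is D′ : List ℕ
      is = map index es
      D′ = filter (λ j → member? _≟_ j D) is

      D′⊆D : ∀ {j} → j ∈ i ∷ D′ → j ∈ D
      D′⊆D (here refl) = i∈D
      D′⊆D (there j∈)  = proj₂ (∈-filter⁻ (λ j → member? _≟_ j D) {xs = is} j∈)

      D⊆D′ : ∀ {j} → j ∈ D → j ∈ i ∷ D′
      D⊆D′ j∈D with D⊆ j∈D
      ... | here refl = here refl
      ... | there j∈  = there (∈-filter⁺ (λ j → member? _≟_ j D) j∈ j∈D)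

    -- Positivity rules out the default value 0 of `max`.
    m-chk-attained : ∀ i es → 0 < m-chk i es →
                     ∃[ D ] ((∀ {j} → j ∈ D → j ∈ map index es) × HasSize (⋂ (i ∷ D)) (m-chk i es))
    m-chk-attained i es pos
      with argmax-sel id 0 (mapMaybe (sizeIfFinite ∘ ⋂) (map (i ∷_) (subcollections (map index es))))
    ... | inj₁ ≡0 = contradiction (sym ≡0) (λ eq → <-irrefl eq pos)
    ... | inj₂ m∈ with ∈-mapMaybe⁻ (sizeIfFinite ∘ ⋂) (map (i ∷_) (subcollections (map index es))) m∈
    ... | E , E∈ , eq with ∈-map⁻ (i ∷_) E∈
    ... | D , D∈ , refl = D , ∈-subcollections⇒⊆ _ D∈ , sizeIfFinite-sound (⋂ (i ∷ D)) eq

    m-chk-∷ : ∀ i e es → m-chk i es ≤ m-chk i (e ∷ es)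
    m-chk-∷ i e es with 0 <? m-chk i es
    ... | no ≡0   = ≤-trans (≮⇒≥ ≡0) z≤n
    ... | yes pos =
      let D , D⊆ , size = m-chk-attained i es pos
      in ⋂-size≤m-chk i (e ∷ es) (here refl)
           (λ { (here refl) → here refl ; (there j∈) → there (there (D⊆ j∈)) }) size

    -- Runs of the insertion loop.

    data Insertion (i : ℕ) : List Entry → ℕ × List Entry → Set where
      first : Insertion i [] (m-chk i [] , entry i (m-chk i []) ∷ [])
      stop  : ∀ {e es} → m e < m-chk i (e ∷ es) →
              Insertion i (e ∷ es) (m-chk i (e ∷ es) , entry i (m-chk i (e ∷ es)) ∷ e ∷ es)
      pass  : ∀ {e es k fs} → m-chk i (e ∷ es) ≤ m e →
              Insertion i es (k , fs) → Insertion i (e ∷ es) (k , e ∷ fs)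

    -- Recasts the Boolean branching of `insert` as a relation that records the comparison made at
    -- each swap or stop, so that later proofs recurse over the run.
    insertion : ∀ i es → Insertion i es (insert i es)
    insertion i []       = first
    insertion i (e ∷ es) = step (m e <? m-chk i (e ∷ es))
      where
      step : (d : Dec (m e < m-chk i (e ∷ es))) → Insertion i (e ∷ es)
        (if does d
         then (m-chk i (e ∷ es) , entry i (m-chk i (e ∷ es)) ∷ e ∷ es)
         else (proj₁ (insert i es) , e ∷ proj₂ (insert i es)))
      step (yes lt) = stop lt
      step (no ≮)   = pass (≮⇒≥ ≮) (insertion i es)

    Sorted : List Entry → Set
    Sorted = AllPairs (λ e f → m f ≤ m e)

    insertion-↭ : ∀ {i es k fs} → Insertion i es (k , fs) → fs ↭ entry i k ∷ es
    insertion-↭ first      = ↭-refl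
    insertion-↭ (stop _)   = ↭-refl
    insertion-↭ (pass _ p) = ↭-trans (↭-prep _ (insertion-↭ p)) (↭-swap _ _ ↭-refl)

    -- Moving towards the front only removes candidate subcollections.
    insertion≤m-chk : ∀ {i es k fs} → Insertion i es (k , fs) → k ≤ m-chk i es
    insertion≤m-chk first      = ≤-refl
    insertion≤m-chk (stop _)   = ≤-refl
    insertion≤m-chk {i} {e ∷ es} (pass _ p) = ≤-trans (insertion≤m-chk p) (m-chk-∷ i e es)

    stop-All< : ∀ {e es k} → m e < k → Sorted (e ∷ es) → All (λ f → m f < k) (e ∷ es)
    stop-All< lt (es≤e ∷ _) = lt ∷ All.map (λ le → ≤-<-trans le lt) es≤e

    insertion-Sorted : ∀ {i es k fs} → Insertion i es (k , fs) → Sorted es → Sorted fs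
    insertion-Sorted first     _      = [] ∷ []
    insertion-Sorted (stop lt) sorted =
      All.map <⇒≤ (stop-All< lt sorted) ∷ sorted
    -- A passed entry `e` still dominates: the final value is at most the value checked when `e` was
    -- passed, hence at most `m e`.
    insertion-Sorted ins@(pass le p) (es≤e ∷ sorted) =
      All-resp-↭ (↭-sym (insertion-↭ p))
        (≤-trans (insertion≤m-chk ins) le ∷ es≤e)
      ∷ insertion-Sorted p sorted

    -- The check that lets `i` pass `e` covers every finite intersection of `i` with entries up to
    -- `e`. If `index e` is in `D`, it bounds `n` by `m e`; otherwise `D` lies within the remaining
    -- entries and the argument continues with them.
    insertion-bound : ∀ {i es k fs D n} → Insertion i es (k , fs) →
                      i ∈ D → (∀ {j} → j ∈ D → j ∈ i ∷ map index es) → HasSize (⋂ D) n →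
                      n ≤ k ⊎ (∃[ e ] (e ∈ es × index e ∈ D × n ≤ m e))
    insertion-bound {i}      first    i∈D D⊆ size = inj₁ (⋂-size≤m-chk i [] i∈D D⊆ size)
    insertion-bound {i} {es} (stop _) i∈D D⊆ size = inj₁ (⋂-size≤m-chk i es i∈D D⊆ size)
    insertion-bound {i} {e ∷ es} {D = D} (pass le p) i∈D D⊆ size with member? _≟_ (index e) D
    ... | yes e∈D = inj₂ (e , here refl , e∈D , ≤-trans (⋂-size≤m-chk i (e ∷ es) i∈D D⊆ size) le)
    ... | no e∉D with insertion-bound p i∈D D⊆′ size
      where
      D⊆′ : ∀ {j} → j ∈ D → j ∈ i ∷ map index es
      D⊆′ j∈D with D⊆ j∈D
      ... | here refl         = here refl
      ... | there (here refl) = contradiction j∈D e∉D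
      ... | there (there j∈)  = there j∈
    ... | inj₁ n≤k                   = inj₁ n≤k
    ... | inj₂ (f , f∈ , f∈D , n≤mf) = inj₂ (f , there f∈ , f∈D , n≤mf)

    -- Passed entries are no longer candidates. At a stop the neighbour has a value below `k`, and
    -- by sortedness so do all entries in front of it.
    insertion-attained : ∀ {i es k fs} → Insertion i es (k , fs) → Sorted es → 0 < k →
                         ∃[ D ] (HasSize (⋂ (i ∷ D)) k ×
                                 (∀ {j} → j ∈ D → ∃[ e ] (e ∈ es × j ≡ index e × m e < k)))
    insertion-attained {i} first _ pos =
      let D , D⊆ , size = m-chk-attained i [] pos
      in D , size , λ j∈D → contradiction (D⊆ j∈D) λ ()
    insertion-attained {i} {es} (stop lt) sorted pos =
      let D , D⊆ , size = m-chk-attained i es pos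
      in D , size , λ j∈D →
           let e , e∈ , eq = ∈-map⁻ index (D⊆ j∈D)
           in e , e∈ , eq , All.lookup (stop-All< lt sorted) e∈
    insertion-attained (pass _ p) (_ ∷ sorted) pos =
      let D , size , D⊆ = insertion-attained p sorted pos
      in D , size , λ j∈D → let e , e∈ , eq , lt = D⊆ j∈D in e , there e∈ , eq , lt

    -- Invariants of the stages and bounds for `m⋆`.

    stage-↭ : ∀ i → stage (suc i) ↭ entry i (m⋆ i) ∷ stage i
    stage-↭ i = insertion-↭ (insertion i (stage i))

    stage-Sorted : ∀ i → Sorted (stage i)
    stage-Sorted zero    = []
    stage-Sorted (suc i) = insertion-Sorted (insertion i (stage i)) (stage-Sorted i)

    -- Later insertions add and permute entries but never alter a stored value.
    stage-entries : ∀ i → All (λ e → index e < i × m e ≡ m⋆ (index e)) (stage i)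
    stage-entries zero    = []
    stage-entries (suc i) = All-resp-↭ (↭-sym (stage-↭ i))
      ((n<1+n i , refl) ∷ All.map (λ (lt , eq) → m<n⇒m<1+n lt , eq) (stage-entries i))

    <⇒∈stage : ∀ {i j} → j < i → j ∈ map index (stage i)
    <⇒∈stage {suc i} j<1+i = ∈-resp-↭ (↭-sym (map⁺ index (stage-↭ i))) (case (m<1+n⇒m<n∨m≡n j<1+i))
      where
      case : ∀ {j} → j < i ⊎ j ≡ i → j ∈ i ∷ map index (stage i)
      case (inj₁ j<i)  = there (<⇒∈stage j<i)
      case (inj₂ refl) = here refl

    -- `b` descends to the largest index in `D`. When that index is inserted, all other members of
    -- `D` are already in the stage, so `insertion-bound` applies.
    m⋆-bound : ∀ b {D d n} → d ∈ D → (∀ {j} → j ∈ D → j < b) → HasSize (⋂ D) n →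
               ∃[ j ] (j ∈ D × n ≤ m⋆ j)
    m⋆-bound zero    d∈D D<b _ = contradiction (D<b d∈D) λ ()
    m⋆-bound (suc b) {D} d∈D D<1+b size with member? _≟_ b D
    ... | no b∉D = m⋆-bound b d∈D D<b size
      where
      D<b : ∀ {j} → j ∈ D → j < b
      D<b j∈D with m<1+n⇒m<n∨m≡n (D<1+b j∈D)
      ... | inj₁ j<b  = j<b
      ... | inj₂ refl = contradiction j∈D b∉D
    ... | yes b∈D with insertion-bound (insertion b (stage b)) b∈D D⊆ size
      where
      D⊆ : ∀ {j} → j ∈ D → j ∈ b ∷ map index (stage b)
      D⊆ j∈D with m<1+n⇒m<n∨m≡n (D<1+b j∈D)
      ... | inj₁ j<b  = there (<⇒∈stage j<b)
      ... | inj₂ refl = here refl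
    ... | inj₁ n≤m⋆b = b , b∈D , n≤m⋆b
    ... | inj₂ (e , e∈ , e∈D , n≤me) =
      index e , e∈D , subst (_ ≤_) (proj₂ (All.lookup (stage-entries b) e∈)) n≤me

    ⋂-size≤m⋆ : ∀ {D d n} → d ∈ D → HasSize (⋂ D) n → ∃[ j ] (j ∈ D × n ≤ m⋆ j)
    ⋂-size≤m⋆ {D} d∈D = m⋆-bound (suc (max 0 D)) d∈D
      λ j∈D → s≤s (v≤max⁺ 0 D (inj₂ (lose j∈D ≤-refl)))

    m⋆-attained : ∀ i → 0 < m⋆ i →
                  ∃[ D ] (HasSize (⋂ (i ∷ D)) (m⋆ i) × (∀ {j} → j ∈ D → j < i × m⋆ j < m⋆ i))
    m⋆-attained i pos =
      let D , size , D⊆ = insertion-attained (insertion i (stage i)) (stage-Sorted i) pos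
      in D , size , λ j∈D → lift (D⊆ j∈D)
      where
      lift : ∀ {j} → ∃[ e ] (e ∈ stage i × j ≡ index e × m e < m⋆ i) → j < i × m⋆ j < m⋆ i
      lift (e , e∈ , refl , lt) =
        let j<i , eq = All.lookup (stage-entries i) e∈ in j<i , subst (_< m⋆ i) eq lt

    -- The generating algorithm.

    time : ℕ → ℕ
    time i = m⋆ i + 1

    Fits : ∀ {t} → Vec U (suc t) → Pred ℕ 0ℓ
    Fits v j = ∀ u → u Vec.∈ v → strings (C j) u

    -- `n` ranges over the sizes of the sample, so it has at most one value; this form needs no
    -- function that counts distinct strings.
    FreshCommon : ∀ {t} → Vec U (suc t) → Pred U 0ℓ
    FreshCommon v u =
      ¬ (u Vec.∈ v) ×
      (∀ n → HasSize (Vec._∈ v) n → ∀ j → time j ≤ n → Fits v j → strings (C j) u)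

    generate : Algorithm U
    generate v with em {∃[ u ] FreshCommon v u}
    ... | yes (u , _) = u
    -- An arbitrary default. Under the finiteness hypothesis, `FreshCommon-exists` excludes this
    -- case whenever some language makes a demand.
    ... | no _        = Vec.head v

    generate-FreshCommon : ∀ {t} (v : Vec U (suc t)) → ∃[ u ] FreshCommon v u →
                           FreshCommon v (generate v)
    generate-FreshCommon v ∃u with em {∃[ u ] FreshCommon v u}
    ... | yes (_ , fresh) = fresh
    ... | no ∄u           = contradiction ∃u ∄u

    module _ (finite : ∀ n → Finite (λ j → time j ≤ n)) where

      FreshCommon-exists : ∀ {t} (v : Vec U (suc t)) {n i} → HasSize (Vec._∈ v) n →
                           time i ≤ n → Fits v i → ∃[ u ] FreshCommon v u
      FreshCommon-exists v {n} {i} size ti≤n fits-i with finite n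
      ... | _ , J , _ , _ , ∈J⇔ = fromDec em
        where
        fits? : Decidable (Fits v)
        fits? j = em

        D : List ℕ
        D = filter fits? J

        ∈D : ∀ {j} → time j ≤ n → Fits v j → j ∈ D
        ∈D tj≤n fits-j = ∈-filter⁺ fits? (from (∈J⇔ _) tj≤n) fits-j

        v⊆⋂D : ∀ u → u Vec.∈ v → ⋂ D u
        v⊆⋂D u u∈v = All.tabulate λ j∈D → proj₂ (∈-filter⁻ fits? {xs = J} j∈D) u u∈v

        fromDec : Dec (∃[ u ] (¬ (u Vec.∈ v) × ⋂ D u)) → ∃[ u ] FreshCommon v u
        fromDec (yes (u , u∉v , u∈⋂D)) = u , u∉v , λ n′ size′ j tj≤n′ fits-j →
          All.lookup u∈⋂D
            (∈D (subst (time j ≤_) (HasSize-unique {P = Vec._∈ v} size′ size) tj≤n′) fits-j)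
        fromDec (no ∄u) =
          let ⋂D⊆v = λ u u∈⋂D → em⇒dne em λ u∉v → ∄u (u , u∉v , u∈⋂D)
              -- The bound needs a nonempty `D`, and `i` is a member.
              j , j∈D , n≤m⋆j = ⋂-size≤m⋆ (∈D ti≤n fits-i)
                (HasSize-resp (λ u → mk⇔ (v⊆⋂D u) (⋂D⊆v u)) size)
              tj≤n = to (∈J⇔ j) (proj₁ (∈-filter⁻ fits? {xs = J} j∈D))
          in contradiction n≤m⋆j (<⇒≱ (<-≤-trans (m<m+n _ (n<1+n 0)) tj≤n))

      generate-correct : NonUniformlyGeneratesWith generate C time
      generate-correct i = m≤n+m 1 (m⋆ i) , λ x (x⊆L , _) t n size ti≤n →
        let fits-i : Fits (prefix x t) i
            fits-i u u∈ = let k , eq = VecAny.tabulate⁻ {f = x ∘ toℕ} u∈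
                          in subst (strings (C i)) (sym eq) (x⊆L (toℕ k))
            fresh , common = generate-FreshCommon (prefix x t)
              (FreshCommon-exists (prefix x t) size ti≤n fits-i)
        in common n size i ti≤n fits-i , fresh

    -- Pareto optimality.

    time-ParetoOptimal : U ↔ ℕ → ParetoOptimal C time
    time-ParetoOptimal U↔ℕ G (τ , G-gen) i (k , ((1≤k , k-gen) , _) , k<ti) =
      -- Generation times are at least 1, so `1 ≤ k ≤ m⋆ i`.
      obstruct (m⋆-attained i (≤-trans 1≤k k≤m⋆i))
      where
      k≤m⋆i : k ≤ m⋆ i
      k≤m⋆i = s≤s⁻¹ (subst (k <_) (+-comm (m⋆ i) 1) k<ti)

      Worse : Set
      Worse = ∃[ j ] (j ≢ i × ∃[ l ] (IsGenerationTime G (C j) l × time j < l))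

      obstruct : ∃[ D ] (HasSize (⋂ (i ∷ D)) (m⋆ i) × (∀ {j} → j ∈ D → j < i × m⋆ j < m⋆ i)) → Worse
      -- The intersection is to serve as a sample, which cannot be empty; its size `m⋆ i` is
      -- positive.
      obstruct (D , ([] , _ , len , _) , _) =
        contradiction (≤-trans 1≤k (subst (k ≤_) (sym len) k≤m⋆i)) λ ()
      obstruct (D , (s ∷ ss , uniq , len , mem) , D<) = fromDec em
        where
        z : U
        z = G (fromList (s ∷ ss))

        output : ∀ {j l} → j ∈ i ∷ D → GeneratesFrom G (C j) l → l ≤ m⋆ i →
                 strings (C j) z × ¬ (z ∈ s ∷ ss)
        output {j} j∈ gen = generatesFrom-fresh U↔ℕ {G} {C j} gen
          (All.tabulate λ u∈ → All.lookup (to (mem _) u∈) j∈)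
          (s ∷ ss , uniq , len , λ _ → mk⇔ id id)

        z-fresh : strings (C i) z × ¬ (z ∈ s ∷ ss)
        z-fresh = output (here refl) (1≤k , k-gen) k≤m⋆i

        fromDec : Dec (Any (λ j → ¬ strings (C j) z) D) → Worse
        -- If `z` lay in every language of `D`, it would lie in the intersection, which is exactly
        -- the sample, against freshness.
        fromDec (no ∄j) = contradiction
          (from (mem z) (proj₁ z-fresh ∷ All.map (em⇒dne em) (¬Any⇒All¬ D ∄j)))
          (proj₂ z-fresh)
        fromDec (yes ∃j) =
          let j , j∈D , z∉Lj = find ∃j
              j<i , m⋆j<m⋆i = D< j∈D
              -- `τ j` is some valid time; the comparison concerns the least one.
              l , l-gen , l-least = least (GeneratesFrom G (C j)) (τ j) (G-gen j)
          in j , <⇒≢ j<i , l , (l-gen , l-least) ,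
             ≤-<-trans (subst (_≤ m⋆ i) (+-comm 1 (m⋆ j)) m⋆j<m⋆i)
               -- A time `l ≤ m⋆ i` would bind `G` on this sample and force `z` into `C j`. Hence
               -- `m⋆ j + 1 ≤ m⋆ i < l`.
               (≰⇒> λ l≤m⋆i → z∉Lj (proj₁ (output (there j∈D) l-gen l≤m⋆i)))

mainTheorem3 : (em : ExcludedMiddle 0ℓ) (U : Set) → U ↔ ℕ → (C : Collection U) →
    (∀ t → Finite (λ j → Procedure.m⋆ em C j + 1 ≤ t)) →
    Σ[ G ∈ Algorithm U ] Σ[ τ ∈ (ℕ → ℕ) ] (NonUniformlyGeneratesWith G C τ × ParetoOptimal C τ)
mainTheorem3 em U U↔ℕ C finite =
  generate em C , time em C , generate-correct em C finite , time-ParetoOptimal em C U↔ℕ
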